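{- For any graph $G$ with no isolated vertex, $$\gamma_{oitR}(G)\leq \min\{\gamma_{t,oi}(G),\gamma_{oiR}(G)\}+\gamma(G).$$
   Context: All graphs are finite, undirected and simple (no loops or multiple edges). $\gamma(G)$ is the domination number: the minimum cardinality of a set $D\subseteq V(G)$ such that every vertex in $V(G)\setminus D$ has a neighbor in $D$. A total dominating set is a set $D\subseteq V(G)$ such that every vertex in $V(G)$ has a neighbor in $D$. A total dominating set $D$ is an outer-independent total dominating set if $V(G)\setminus D$ is an independent set; $\gamma_{t,oi}(G)$ is the minimum cardinality of such a set. For a function $f:V(G)\to\{0,1,2\}$, let $V_i=\{v\in V(G): f(v)=i\}$ for $i\in\{0,1,2\}$; the weight of $f$ is $\omega(f)=\sum_{v\in V(G)}f(v)$. The function $f$ is an outer-independent Roman dominating function if every vertex in $V_0$ is adjacent to at least one vertex in $V_2$ and $V_0$ is an independent set; $\gamma_{oiR}(G)$ is the minimum weight of such a function. The function $f$ (on a graph with no isolated vertex) is an outer-independent total Roman dominating function if, in addition, the subgraph induced by $V_1\cup V_2$ has no isolated vertex; $\gamma_{oitR}(G)$ is the minimum weight of such a function. -}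

module Defs where

open import Data.Fin.Base using (Fin; toℕ)
open import Data.Fin.Patterns using (0F; 1F; 2F)
import Data.Fin.Properties as Fin
open import Data.Fin.Subset using (Subset; _∈_; _∉_; ∣_∣; ⊤)
open import Data.Fin.Subset.Properties using (_∈?_; ∈⊤; anySubset?)
open import Data.Nat.Base using (ℕ; zero; suc; _≤_; _<_)
open import Data.Nat.Induction using (Acc; acc; <-wellFounded)
open import Data.Nat.Properties using (_<?_; ≮⇒≥)
open import Data.Product.Base using (∃; _×_; _,_)
open import Data.Sum.Base using (inj₁; inj₂)
open import Data.Vec.Base using (Vec; []; _∷_; lookup; replicate; sum; map)
open import Data.Vec.Properties using (lookup-replicate)
open import Relation.Binary.PropositionalEquality using (_≡_; sym; trans)
open import Relation.Nullary using (¬_; Dec; yes; no; contradiction)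
open import Relation.Nullary.Decidable using (_×-dec_; _→-dec_; ¬?; map′)
open import Relation.Unary using (Pred; Decidable; _∪_)
open import Relation.Unary.Properties using (_∪?_)

record Minimum {A : Set} (P : A → Set) (w : A → ℕ) : Set where
  field
    argmin   : A
    feasible : P argmin
    least    : ∀ x → P x → w argmin ≤ w x

  value : ℕ
  value = w argmin

Searchable : Set → Set₁
Searchable A = ∀ {P : A → Set} → Decidable P → Dec (∃ P)

minimise : ∀ {A : Set} {P : A → Set} → Searchable A → Decidable P →
           (w : A → ℕ) → ∃ P → Minimum P w
minimise {A} {P} search P? w (x₀ , p₀) = go x₀ p₀ (<-wellFounded (w x₀))
  where
  go : ∀ x → P x → Acc _<_ (w x) → Minimum P w
  go x p (acc rs) with search (λ y → P? y ×-dec (w y <? w x))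
  ... | yes (y , q , y<x) = go y q (rs y<x)
  ... | no none = record
    { argmin   = x
    ; feasible = p
    ; least    = λ y q → ≮⇒≥ (λ y<x → none (y , q , y<x))
    }

searchVec : ∀ {A : Set} → Searchable A → ∀ {n} → Searchable (Vec A n)
searchVec search {zero} P? =
  map′ (λ p → [] , p) (λ { ([] , p) → p }) (P? [])
searchVec search {suc n} P? =
  map′ (λ (x , xs , p) → x ∷ xs , p) (λ { (x ∷ xs , p) → x , xs , p })
       (search (λ x → searchVec search (λ xs → P? (x ∷ xs))))

record Graph : Set₁ where
  field
    order     : ℕ
    Adj       : Fin order → Fin order → Set
    Adj?      : ∀ u v → Dec (Adj u v)
    symmetric : ∀ {u v} → Adj u v → Adj v u
    loopless  : ∀ {v} → ¬ Adj v v

module _ (G : Graph) where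
  open Graph G

  Vertex : Set
  Vertex = Fin order

  HasNeighbourIn : Pred Vertex _ → Vertex → Set
  HasNeighbourIn S v = ∃ λ u → S u × Adj v u

  NoIsolatedVertex : Set
  NoIsolatedVertex = ∀ v → ∃ λ u → Adj v u

  InducedNoIsolatedVertex : Pred Vertex _ → Set
  InducedNoIsolatedVertex S = ∀ v → S v → HasNeighbourIn S v

  Independent : Pred Vertex _ → Set
  Independent S = ∀ u v → S u → S v → ¬ Adj u v

  Dominating : Subset order → Set
  Dominating D = ∀ v → v ∉ D → HasNeighbourIn (_∈ D) v

  TotalDominating : Subset order → Set
  TotalDominating D = ∀ v → HasNeighbourIn (_∈ D) v

  OuterIndependentTotalDominating : Subset order → Set
  OuterIndependentTotalDominating D =
    TotalDominating D × Independent (_∉ D)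

  -- A vector of values rather than a function Fin order → Fin 3, so that
  -- searching all labellings does not need function extensionality.
  Labelling : Set
  Labelling = Vec (Fin 3) order

  weight : Labelling → ℕ
  weight f = sum (map toℕ f)

  V : Fin 3 → Labelling → Pred Vertex _
  V i f v = lookup f v ≡ i

  OuterIndependentRomanDominating : Labelling → Set
  OuterIndependentRomanDominating f =
    (∀ v → V 0F f v → HasNeighbourIn (V 2F f) v) × Independent (V 0F f)

  OuterIndependentTotalRomanDominating : Labelling → Set
  OuterIndependentTotalRomanDominating f =
    OuterIndependentRomanDominating f ×
    InducedNoIsolatedVertex (V 1F f ∪ V 2F f)

  hasNeighbourIn? : ∀ {S} → Decidable S → Decidable (HasNeighbourIn S)
  hasNeighbourIn? S? v = Fin.any? (λ u → S? u ×-dec Adj? v u)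

  independent? : ∀ {S} → Decidable S → Dec (Independent S)
  independent? S? = Fin.all? λ u → Fin.all? λ v →
    S? u →-dec (S? v →-dec ¬? (Adj? u v))

  dominating? : Decidable Dominating
  dominating? D = Fin.all? λ v →
    ¬? (v ∈? D) →-dec hasNeighbourIn? (_∈? D) v

  oiTotalDominating? : Decidable OuterIndependentTotalDominating
  oiTotalDominating? D =
    Fin.all? (hasNeighbourIn? (_∈? D)) ×-dec
    independent? (λ v → ¬? (v ∈? D))

  V? : ∀ i f → Decidable (V i f)
  V? i f v = lookup f v Fin.≟ i

  oiRomanDominating? : Decidable OuterIndependentRomanDominating
  oiRomanDominating? f =
    (Fin.all? λ v → V? 0F f v →-dec hasNeighbourIn? (V? 2F f) v) ×-dec
    independent? (V? 0F f)

  oiTotalRomanDominating? : Decidable OuterIndependentTotalRomanDominating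
  oiTotalRomanDominating? f =
    oiRomanDominating? f ×-dec
    (Fin.all? λ v → V₁₂? v →-dec hasNeighbourIn? V₁₂? v)
    where
    V₁₂? : Decidable (V 1F f ∪ V 2F f)
    V₁₂? = V? 1F f ∪? V? 2F f

  ones : Labelling
  ones = replicate order 1F

  ones-V₀-empty : ∀ v → ¬ V 0F ones v
  ones-V₀-empty v v∈V₀ with trans (sym (lookup-replicate v 1F)) v∈V₀
  ... | ()

  ⊤-dominating : Dominating ⊤
  ⊤-dominating v v∉⊤ = contradiction ∈⊤ v∉⊤

  ⊤-oiTotalDominating : NoIsolatedVertex → OuterIndependentTotalDominating ⊤
  ⊤-oiTotalDominating nbr =
    (λ v → let (u , v~u) = nbr v in u , ∈⊤ , v~u) ,
    (λ u v u∉⊤ _ → contradiction ∈⊤ u∉⊤)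

  ones-oiRomanDominating : OuterIndependentRomanDominating ones
  ones-oiRomanDominating =
    (λ v v∈V₀ → contradiction v∈V₀ (ones-V₀-empty v)) ,
    (λ u v u∈V₀ _ → contradiction u∈V₀ (ones-V₀-empty u))

  ones-oiTotalRomanDominating :
    NoIsolatedVertex → OuterIndependentTotalRomanDominating ones
  ones-oiTotalRomanDominating nbr =
    ones-oiRomanDominating ,
    λ v _ → let (u , v~u) = nbr v in u , inj₁ (lookup-replicate u 1F) , v~u

  minDominating : Minimum Dominating ∣_∣
  minDominating =
    minimise anySubset? dominating? ∣_∣ (⊤ , ⊤-dominating)

  minOITotalDominating :
    NoIsolatedVertex → Minimum OuterIndependentTotalDominating ∣_∣
  minOITotalDominating nbr =
    minimise anySubset? oiTotalDominating? ∣_∣ (⊤ , ⊤-oiTotalDominating nbr)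

  minOIRomanDominating : Minimum OuterIndependentRomanDominating weight
  minOIRomanDominating =
    minimise (searchVec Fin.any?) oiRomanDominating? weight
      (ones , ones-oiRomanDominating)

  minOITotalRomanDominating :
    NoIsolatedVertex → Minimum OuterIndependentTotalRomanDominating weight
  minOITotalRomanDominating nbr =
    minimise (searchVec Fin.any?) oiTotalRomanDominating? weight
      (ones , ones-oiTotalRomanDominating nbr)

  γ : ℕ
  γ = Minimum.value minDominating

  -- The hypothesis guarantees that a feasible set exists; the value does
  -- not depend on how it is proved.
  γ-t,oi : NoIsolatedVertex → ℕ
  γ-t,oi nbr = Minimum.value (minOITotalDominating nbr)

  γ-oiR : ℕ
  γ-oiR = Minimum.value minOIRomanDominating

  γ-oitR : NoIsolatedVertex → ℕ
  γ-oitR nbr = Minimum.value (minOITotalRomanDominating nbr)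

{-# OPTIONS --safe #-}
-- Let S be a minimum dominating set, and add 1 (capped at 2) to the labels on
-- a set of at most |S| vertices.
--
-- Start from the indicator of an outer-independent total dominating set D and
-- add 1 on S. A vertex labelled 0 lies outside D ∪ S; its neighbour in S must
-- lie in D because V ∖ D is independent, so that neighbour is labelled 2.
--
-- Start from an outer-independent Roman dominating f and add 1 on r(S), where
-- r fixes the zeros of f and sends every other vertex to some neighbour. A
-- vertex v with f v > 0 then has a positive neighbour: r v if v ∈ S, and
-- otherwise its neighbour in S. A vertex with f v = 0 has a neighbour labelled 2.
module Submission where

open import Defs
open import Data.Bool.Base using (if_then_else_)
open import Data.Fin.Base using (Fin; zero; suc; toℕ)
open import Data.Fin.Patterns using (0F; 1F; 2F)
import Data.Fin.Properties as Fin
open import Data.Fin.Subset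
  using (Subset; inside; outside; _∈_; _∉_; ∣_∣; ⊥; ⁅_⁆; _∪_)
open import Data.Fin.Subset.Properties
  using (_∈?_; x∈⁅x⁆; ∣⁅x⁆∣≡1; ∣⊥∣≡0; p⊆p∪q; q⊆p∪q)
open import Data.Nat.Base using (ℕ; zero; suc; _≤_; _+_; _⊓_; z≤n; s≤s)
open import Data.Nat.Properties
open import Data.Product.Base using (_,_; proj₁; proj₂)
open import Data.Sum.Base using (_⊎_; inj₁; inj₂)
open import Data.Vec.Base
  using (Vec; []; _∷_; lookup; replicate; sum; map; zipWith; here; there)
open import Data.Vec.Properties
  using (lookup-zipWith; lookup-replicate; []=⇒lookup)
open import Function.Base using (_∘_)
open import Relation.Binary.PropositionalEquality
  using (_≡_; _≢_; refl; sym; trans; cong; subst)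
open import Relation.Nullary using (yes; no; contradiction)

private
  variable
    m n : ℕ

∣p∪q∣≤∣p∣+∣q∣ : (p q : Subset n) → ∣ p ∪ q ∣ ≤ ∣ p ∣ + ∣ q ∣
∣p∪q∣≤∣p∣+∣q∣ []            []            = z≤n
∣p∪q∣≤∣p∣+∣q∣ (outside ∷ p) (outside ∷ q) = ∣p∪q∣≤∣p∣+∣q∣ p q
∣p∪q∣≤∣p∣+∣q∣ (outside ∷ p) (inside  ∷ q) =
  ≤-trans (s≤s (∣p∪q∣≤∣p∣+∣q∣ p q)) (≤-reflexive (sym (+-suc ∣ p ∣ ∣ q ∣)))
∣p∪q∣≤∣p∣+∣q∣ (inside  ∷ p) (outside ∷ q) = s≤s (∣p∪q∣≤∣p∣+∣q∣ p q)
-- A common element counts twice on the right, so this case has one to spare.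
∣p∪q∣≤∣p∣+∣q∣ (inside  ∷ p) (inside  ∷ q) =
  s≤s (≤-trans (∣p∪q∣≤∣p∣+∣q∣ p q) (+-monoʳ-≤ ∣ p ∣ (n≤1+n ∣ q ∣)))

-- One singleton per element of the subset, so the size bound goes by induction even when `r` merges
-- vertices.
image : (Fin m → Fin n) → Subset m → Subset n
image r []            = ⊥
image r (inside  ∷ S) = ⁅ r zero ⁆ ∪ image (r ∘ suc) S
image r (outside ∷ S) = image (r ∘ suc) S

∈-image : (r : Fin m → Fin n) {S : Subset m} {v : Fin m} → v ∈ S → r v ∈ image r S
∈-image r {inside  ∷ S} here        = p⊆p∪q (image (r ∘ suc) S) (x∈⁅x⁆ (r zero))
∈-image r {inside  ∷ S} (there v∈S) = q⊆p∪q ⁅ r zero ⁆ _ (∈-image (r ∘ suc) v∈S)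
∈-image r {outside ∷ S} (there v∈S) = ∈-image (r ∘ suc) v∈S

∣image∣≤ : (r : Fin m → Fin n) (S : Subset m) → ∣ image r S ∣ ≤ ∣ S ∣
∣image∣≤ {n = n} r []    = ≤-reflexive (∣⊥∣≡0 n)
∣image∣≤ r (outside ∷ S) = ∣image∣≤ (r ∘ suc) S
∣image∣≤ r (inside  ∷ S) = begin
  ∣ ⁅ r zero ⁆ ∪ image (r ∘ suc) S ∣     ≤⟨ ∣p∪q∣≤∣p∣+∣q∣ ⁅ r zero ⁆ _ ⟩
  ∣ ⁅ r zero ⁆ ∣ + ∣ image (r ∘ suc) S ∣ ≡⟨ cong (_+ ∣ image (r ∘ suc) S ∣) (∣⁅x⁆∣≡1 (r zero)) ⟩
  suc ∣ image (r ∘ suc) S ∣              ≤⟨ s≤s (∣image∣≤ (r ∘ suc) S) ⟩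
  suc ∣ S ∣                              ∎
  where open ≤-Reasoning

increment : Fin 3 → Fin 3
increment 0F = 1F
increment 1F = 2F
increment 2F = 2F

increment≢0 : ∀ i → increment i ≢ 0F
increment≢0 0F ()
increment≢0 1F ()
increment≢0 2F ()

toℕ-increment : ∀ i → toℕ (increment i) ≤ suc (toℕ i)
toℕ-increment 0F = ≤-refl
toℕ-increment 1F = ≤-refl
toℕ-increment 2F = n≤1+n 2

-- Applied to the all-zero labelling this gives the indicator of a set, so the lemmas on `boost`
-- serve both constructions.
boost : Vec (Fin 3) n → Subset n → Vec (Fin 3) n
boost = zipWith λ i s → if s then increment i else i

weight-boost : (f : Vec (Fin 3) n) (S : Subset n) →
               sum (map toℕ (boost f S)) ≤ sum (map toℕ f) + ∣ S ∣
weight-boost []      []            = z≤n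
weight-boost (i ∷ f) (outside ∷ S) = begin
  toℕ i + sum (map toℕ (boost f S))   ≤⟨ +-monoʳ-≤ (toℕ i) (weight-boost f S) ⟩
  toℕ i + (sum (map toℕ f) + ∣ S ∣)   ≡⟨ +-assoc (toℕ i) _ _ ⟨
  toℕ i + sum (map toℕ f) + ∣ S ∣     ∎
  where open ≤-Reasoning
weight-boost (i ∷ f) (inside ∷ S) = begin
  toℕ (increment i) + sum (map toℕ (boost f S)) ≤⟨ +-mono-≤ (toℕ-increment i) (weight-boost f S) ⟩
  suc (toℕ i + (sum (map toℕ f) + ∣ S ∣))       ≡⟨ cong suc (+-assoc (toℕ i) _ _) ⟨
  suc (toℕ i + sum (map toℕ f) + ∣ S ∣)         ≡⟨ +-suc _ ∣ S ∣ ⟨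
  toℕ i + sum (map toℕ f) + suc ∣ S ∣           ∎
  where open ≤-Reasoning

weight-zeros : ∀ n → sum (map toℕ (replicate {A = Fin 3} n 0F)) ≡ 0
weight-zeros zero    = refl
weight-zeros (suc n) = weight-zeros n

module _ (f : Vec (Fin 3) n) (S : Subset n) {v : Fin n} where

  lookup-boost-∈ : v ∈ S → lookup (boost f S) v ≡ increment (lookup f v)
  lookup-boost-∈ v∈S = trans (lookup-zipWith _ v f S)
    (cong (if_then increment (lookup f v) else lookup f v) ([]=⇒lookup v∈S))

  boost≢0-∈ : v ∈ S → lookup (boost f S) v ≢ 0F
  boost≢0-∈ v∈S eq = increment≢0 (lookup f v) (trans (sym (lookup-boost-∈ v∈S)) eq)

  -- The cap at 2 makes both branches agree; vertices of `V₂` thus keep dominating their neighbours.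
  boost-2 : lookup f v ≡ 2F → lookup (boost f S) v ≡ 2F
  boost-2 eq rewrite lookup-zipWith (λ i s → if s then increment i else i) v f S | eq
    with lookup S v
  ... | inside  = refl
  ... | outside = refl

  -- An incremented label is never 0, so boosting only shrinks the zero set, which therefore stays
  -- independent.
  boost≡0⇒≡0 : lookup (boost f S) v ≡ 0F → lookup f v ≡ 0F
  boost≡0⇒≡0 eq rewrite lookup-zipWith (λ i s → if s then increment i else i) v f S
    with lookup S v
  ... | inside  = contradiction eq (increment≢0 (lookup f v))
  ... | outside = eq

module _ (G : Graph) where
  open Graph G

  ≢0⇒V₁∪V₂ : ∀ f {v} → lookup f v ≢ 0F → V G 1F f v ⊎ V G 2F f v
  ≢0⇒V₁∪V₂ f {v} f≢0 with lookup f v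
  ... | 0F = contradiction refl f≢0
  ... | 1F = inj₁ refl
  ... | 2F = inj₂ refl

  V₁∪V₂⇒≢0 : ∀ f {v} → V G 1F f v ⊎ V G 2F f v → lookup f v ≢ 0F
  V₁∪V₂⇒≢0 f (inj₁ f≡1) f≡0 with () ← trans (sym f≡1) f≡0
  V₁∪V₂⇒≢0 f (inj₂ f≡2) f≡0 with () ← trans (sym f≡2) f≡0

  module _ (noIsolated : NoIsolatedVertex G) {D S}
           (oitd : OuterIndependentTotalDominating G D)
           (dom : Dominating G S) where

    private
      zeros indicator g : Labelling G
      zeros     = replicate order 0F
      indicator = boost zeros D
      g         = boost indicator S

      V₀⇒∉D : ∀ {v} → V G 0F g v → v ∉ D
      V₀⇒∉D g≡0 v∈D = boost≢0-∈ zeros D v∈D (boost≡0⇒≡0 indicator S g≡0)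

      -- The label is 0 + 1 + 1: one increment from `D` and one from `S`.
      ∈D∩S⇒V₂ : ∀ {v} → v ∈ D → v ∈ S → V G 2F g v
      ∈D∩S⇒V₂ {v} v∈D v∈S = trans (lookup-boost-∈ indicator S v∈S)
        (cong increment (trans (lookup-boost-∈ zeros D v∈D)
          (cong increment (lookup-replicate v 0F))))

      V₀-dominated : ∀ v → V G 0F g v → HasNeighbourIn G (V G 2F g) v
      V₀-dominated v g≡0 with dom v (λ v∈S → boost≢0-∈ indicator S v∈S g≡0)
      ... | u , u∈S , v~u with u ∈? D
      ...   | yes u∈D = u , ∈D∩S⇒V₂ u∈D u∈S , v~u
      ...   | no  u∉D = contradiction v~u (proj₂ oitd v u (V₀⇒∉D g≡0) u∉D)

      g-feasible : OuterIndependentTotalRomanDominating G g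
      g-feasible =
        (V₀-dominated , λ u v u∈V₀ v∈V₀ → proj₂ oitd u v (V₀⇒∉D u∈V₀) (V₀⇒∉D v∈V₀)) ,
        -- Totality of `D` gives each vertex a neighbour in `D`, whose label is at least 1 in
        -- `indicator` and cannot drop to 0 in `g`.
        λ v _ → let (u , u∈D , v~u) = proj₁ oitd v in
          u , ≢0⇒V₁∪V₂ g (boost≢0-∈ zeros D u∈D ∘ boost≡0⇒≡0 indicator S) , v~u

    γ-oitR≤∣oitd∣+∣dom∣ : γ-oitR G noIsolated ≤ ∣ D ∣ + ∣ S ∣
    γ-oitR≤∣oitd∣+∣dom∣ = begin
      γ-oitR G noIsolated             ≤⟨ least g g-feasible ⟩
      weight G g                      ≤⟨ weight-boost indicator S ⟩
      weight G indicator + ∣ S ∣      ≤⟨ +-monoˡ-≤ ∣ S ∣ (weight-boost zeros D) ⟩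
      weight G zeros + ∣ D ∣ + ∣ S ∣  ≡⟨ cong (λ k → k + ∣ D ∣ + ∣ S ∣) (weight-zeros order) ⟩
      ∣ D ∣ + ∣ S ∣                   ∎
      where
      open ≤-Reasoning
      open Minimum (minOITotalRomanDominating G noIsolated) using (least)

  module _ (noIsolated : NoIsolatedVertex G) f {S}
           (oird : OuterIndependentRomanDominating G f)
           (dom : Dominating G S) where

    private
      r : Vertex G → Vertex G
      r v with lookup f v Fin.≟ 0F
      ... | yes _ = v
      ... | no  _ = proj₁ (noIsolated v)

      r-zero : ∀ {v} → lookup f v ≡ 0F → r v ≡ v
      r-zero {v} f≡0 with lookup f v Fin.≟ 0F
      ... | yes _   = refl
      ... | no  f≢0 = contradiction f≡0 f≢0

      r-adj : ∀ {v} → lookup f v ≢ 0F → Adj v (r v)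
      r-adj {v} f≢0 with lookup f v Fin.≟ 0F
      ... | yes f≡0 = contradiction f≡0 f≢0
      ... | no  _   = proj₂ (noIsolated v)

      g : Labelling G
      g = boost f (image r S)

      -- A zero of `g` is a zero of `f`, hence fixed by `r`; if it lay in `S`, it would lie in
      -- `image r S` and be incremented. This is why `r` leaves zeros in place.
      ∈S⇒≢0 : ∀ {v} → v ∈ S → lookup g v ≢ 0F
      ∈S⇒≢0 {v} v∈S g≡0 = boost≢0-∈ f (image r S)
        (subst (_∈ image r S) (r-zero (boost≡0⇒≡0 f (image r S) g≡0)) (∈-image r v∈S))
        g≡0

      V₀-dominated : ∀ v → V G 0F f v → HasNeighbourIn G (V G 2F g) v
      V₀-dominated v f≡0 = let (u , f≡2 , v~u) = proj₁ oird v f≡0 in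
        u , boost-2 f (image r S) f≡2 , v~u

      -- Zeros of `f` are covered as well, since `r` fixes them and those in `S` become positive in
      -- `g`.
      positive-neighbour : ∀ v → HasNeighbourIn G (λ u → lookup g u ≢ 0F) v
      positive-neighbour v with lookup f v Fin.≟ 0F | v ∈? S
      ... | yes f≡0 | _       = let (u , g≡2 , v~u) = V₀-dominated v f≡0 in
                                u , V₁∪V₂⇒≢0 g (inj₂ g≡2) , v~u
      -- Here `r v` is a true neighbour of `v`, and the increment makes it positive whatever its
      -- label in `f`.
      ... | no  f≢0 | yes v∈S = r v , boost≢0-∈ f (image r S) (∈-image r v∈S) , r-adj f≢0
      ... | no  _   | no  v∉S = let (u , u∈S , v~u) = dom v v∉S in
                                u , ∈S⇒≢0 u∈S , v~u

      g-feasible : OuterIndependentTotalRomanDominating G g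
      g-feasible =
        ((λ v → V₀-dominated v ∘ boost≡0⇒≡0 f (image r S)) ,
         λ u v u∈V₀ v∈V₀ → proj₂ oird u v
           (boost≡0⇒≡0 f (image r S) u∈V₀) (boost≡0⇒≡0 f (image r S) v∈V₀)) ,
        λ v _ → let (u , g≢0 , v~u) = positive-neighbour v in
          u , ≢0⇒V₁∪V₂ g g≢0 , v~u

    γ-oitR≤weight-oird+∣dom∣ : γ-oitR G noIsolated ≤ weight G f + ∣ S ∣
    γ-oitR≤weight-oird+∣dom∣ = begin
      γ-oitR G noIsolated         ≤⟨ least g g-feasible ⟩
      weight G g                  ≤⟨ weight-boost f (image r S) ⟩
      weight G f + ∣ image r S ∣  ≤⟨ +-monoʳ-≤ (weight G f) (∣image∣≤ r S) ⟩
      weight G f + ∣ S ∣          ∎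
      where
      open ≤-Reasoning
      open Minimum (minOITotalRomanDominating G noIsolated) using (least)

theorem2p8 : (G : Graph) (noIsolated : NoIsolatedVertex G) →
    γ-oitR G noIsolated ≤ (γ-t,oi G noIsolated ⊓ γ-oiR G) + γ G
theorem2p8 G noIsolated = begin
  γ-oitR G noIsolated
    -- Both bounds hold for arbitrary feasible pairs; each is taken at minimisers, with the same
    -- minimum dominating set.
    ≤⟨ ⊓-glb (γ-oitR≤∣oitd∣+∣dom∣ G noIsolated γtoi.feasible γdom.feasible)
             (γ-oitR≤weight-oird+∣dom∣ G noIsolated γoiR.argmin γoiR.feasible γdom.feasible) ⟩
  (γ-t,oi G noIsolated + γ G) ⊓ (γ-oiR G + γ G)
    ≡⟨ +-distribʳ-⊓ (γ G) (γ-t,oi G noIsolated) (γ-oiR G) ⟨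
  (γ-t,oi G noIsolated ⊓ γ-oiR G) + γ G
    ∎
  where
  open ≤-Reasoning
  module γdom = Minimum (minDominating G)
  module γtoi = Minimum (minOITotalDominating G noIsolated)
  module γoiR = Minimum (minOIRomanDominating G)
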